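{- Let $AP$ be a set of atomic propositions and $Ag$ a finite set of agents. Global and local announcement logic (GLAL), with language $\mathcal{L}_{glal}$, is strictly more expressive than public announcement logic (PAL, with common knowledge), with language $\mathcal{L}_{pal}$. That is: (1) every formula of $\mathcal{L}_{pal}$ is equivalent to some formula of $\mathcal{L}_{glal}$; and (2) there is a formula of $\mathcal{L}_{glal}$ that is not equivalent to any formula of $\mathcal{L}_{pal}$. Here two formulas are equivalent if they are satisfied at exactly the same pointed models $(\mathcal{M},w)$.
   Context: Languages. $AP$ is a set of atoms and $Ag$ a finite set of agents. For $p\in AP$ and $A\subseteq Ag$, the formulas of $\mathcal{L}_{glal}$ are $\psi ::= p \mid \neg\psi \mid \psi\land\psi \mid C_A\psi \mid [\psi]^+_A\psi \mid [\psi]^-_A\psi$, and the formulas of $\mathcal{L}_{pal}$ are $\psi ::= p \mid \neg\psi \mid \psi\land\psi \mid C_A\psi \mid [\psi]\psi$. Models. A (Kripke) model is $\mathcal{M}=\langle W,\{R_a\}_{a\in Ag},V\rangle$ with $W$ a set of worlds, each $R_a$ an equivalence relation on $W$, and $V:AP\to 2^W$. A pointed model is a pair $(\mathcal{M},w)$ with $w\in W$. For $w\in W$, $R_a(w)=\{w' : R_a(w,w')\}$; for $A\subseteq Ag$, $R^C_A=(\bigcup_{a\in A}R_a)^*$ is the reflexive and transitive closure of the union, and $R^C_A(w)=\{w' : R^C_A(w,w')\}$. Semantics. The satisfaction set $[\![\varphi]\!]_{\mathcal{M}}\subseteq W$ is defined by: $[\![p]\!]_{\mathcal{M}}=V(p)$;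 $[\![\neg\psi]\!]_{\mathcal{M}}=W\setminus[\![\psi]\!]_{\mathcal{M}}$; $[\![\psi\land\psi']\!]_{\mathcal{M}}=[\![\psi]\!]_{\mathcal{M}}\cap[\![\psi']\!]_{\mathcal{M}}$; $[\![C_A\psi]\!]_{\mathcal{M}}=\{w : R^C_A(w)\subseteq[\![\psi]\!]_{\mathcal{M}}\}$; for $\star\in\{+,-\}$, $[\![[\psi]^\star_A\psi']\!]_{\mathcal{M}}=\{w : \text{if } w\in[\![\psi]\!]_{\mathcal{M}} \text{ then } w\in[\![\psi']\!]_{\mathcal{M}^\star_{(w,\psi,A)}}\}$; and $[\![[\psi]\psi']\!]_{\mathcal{M}}=\{w : \text{if } w\in[\![\psi]\!]_{\mathcal{M}} \text{ then } w\in[\![\psi']\!]_{\mathcal{M}_\psi}\}$. The refinements $\mathcal{M}^-_{(w,\psi,A)}$ and $\mathcal{M}^+_{(w,\psi,A)}$ have the same worlds and valuation as $\mathcal{M}$ and relations $R^-_b=R^+_b=R_b$ for $b\notin A$, while for $a\in A$: $R^-_a(v)=R_a(v)\cap[\![\psi]\!]_{\mathcal{M}}$ if $v\in R_a(w)\cap[\![\psi]\!]_{\mathcal{M}}$; $R^-_a(v)=R_a(v)\cap[\![\neg\psi]\!]_{\mathcal{M}}$ if $v\in R_a(w)\cap[\![\neg\psi]\!]_{\mathcal{M}}$; $R^-_a(v)=R_a(v)$ otherwise; and $R^+_a(v)$ is defined by the same three cases with $R_a(w)$ replaced by $R^C_A(w)$ in the case conditions. The model $\mathcal{M}_\psi$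 is the restriction of $\mathcal{M}$ to $[\![\psi]\!]_{\mathcal{M}}$: its worlds are $W\cap[\![\psi]\!]_{\mathcal{M}}$, its relations $R_a\cap([\![\psi]\!]_{\mathcal{M}}\times[\![\psi]\!]_{\mathcal{M}})$, its valuation $p\mapsto V(p)\cap[\![\psi]\!]_{\mathcal{M}}$. We write $(\mathcal{M},w)\models\varphi$ ("$\varphi$ is satisfied at $(\mathcal{M},w)$") for $w\in[\![\varphi]\!]_{\mathcal{M}}$.
   Formalization: Part (2) is stated for a nonempty set of atomic propositions and at least two agents; with no atoms there are no formulas, and with at most one agent GLAL and PAL are equally expressive, so (2) fails there. -}

module Defs where

open import Level using (Level; _⊔_) renaming (suc to lsuc)
open import Data.Bool.Base using (if_then_else_)
open import Data.Fin.Base using (Fin)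
open import Data.Fin.Subset using (Subset) renaming (_∈_ to _∈ˢ_)
open import Data.Fin.Subset.Properties using (_∈?_)
open import Data.Nat.Base using (ℕ)
open import Data.Product.Base using (Σ; ∃; _×_; _,_; proj₁)
open import Data.Sum.Base using (_⊎_)
open import Function.Bundles using (_⇔_)
open import Relation.Binary.Core using (Rel)
open import Relation.Binary.Structures using (IsEquivalence)
open import Relation.Binary.Construct.Closure.ReflexiveTransitive using (Star)
open import Relation.Nullary.Decidable.Core using (does)
open import Relation.Unary using (Pred; _∈_; _∉_; _∩_; _⊆_; ∁)

private
  variable
    α ℓ : Level
    AP  : Set α
    n   : ℕ

-- Throughout, the finite set of agents is Fin n.

data GLAL (AP : Set α) (n : ℕ) : Set α where
  atom      : AP → GLAL AP n
  ¬′_       : GLAL AP n → GLAL AP n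
  _∧′_      : GLAL AP n → GLAL AP n → GLAL AP n
  C         : Subset n → GLAL AP n → GLAL AP n
  [_]⁺⟨_⟩_  : GLAL AP n → Subset n → GLAL AP n → GLAL AP n
  [_]⁻⟨_⟩_  : GLAL AP n → Subset n → GLAL AP n → GLAL AP n

data PAL (AP : Set α) (n : ℕ) : Set α where
  atom   : AP → PAL AP n
  ¬′_    : PAL AP n → PAL AP n
  _∧′_   : PAL AP n → PAL AP n → PAL AP n
  C      : Subset n → PAL AP n → PAL AP n
  [_]′_  : PAL AP n → PAL AP n → PAL AP n

record Structure (AP : Set α) (n : ℕ) (ℓ : Level) : Set (α ⊔ lsuc ℓ) where
  field
    W : Set ℓ
    R : Fin n → Rel W ℓ
    V : AP → Pred W ℓ

  Rᶜ : Subset n → Rel W ℓ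
  Rᶜ A = Star (λ v u → ∃ λ a → a ∈ˢ A × R a v u)

-- Satisfaction is defined on all structures, because showing that the
-- refinements below preserve equivalence relations requires excluded middle.
-- Equivalence of formulas quantifies over models only.
record Model (AP : Set α) (n : ℕ) (ℓ : Level) : Set (α ⊔ lsuc ℓ) where
  field
    structure     : Structure AP n ℓ
  open Structure structure public
  field
    isEquivalence : ∀ a → IsEquivalence (R a)

open Structure

-- The three-case refinement of R: S is the set R_a(w) or R^C_A(w) of the case
-- conditions, and P is the satisfaction set of the announced formula.
split : {W : Set ℓ} → Rel W ℓ → Pred W ℓ → Pred W ℓ → Rel W ℓ
split R S P v u =
    (v ∈ S ∩ P × u ∈ R v ∩ P)
  ⊎ (v ∈ S ∩ ∁ P × u ∈ R v ∩ ∁ P)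
  ⊎ (v ∉ S ∩ P × v ∉ S ∩ ∁ P × u ∈ R v)

refine⁻ refine⁺ : (M : Structure AP n ℓ) → W M → Pred (W M) ℓ → Subset n →
                  Structure AP n ℓ
refine⁻ M w P A = record
  { W = W M
  ; R = λ b → if does (b ∈? A) then split (R M b) (R M b w) P else R M b
  ; V = V M
  }
refine⁺ M w P A = record
  { W = W M
  ; R = λ b → if does (b ∈? A) then split (R M b) (Rᶜ M A w) P else R M b
  ; V = V M
  }

-- A world of the restriction carries a proof of membership in P; neither the
-- relations nor the valuation depend on which proof it is.
restrict : (M : Structure AP n ℓ) → Pred (W M) ℓ → Structure AP n ℓ
restrict M P = record
  { W = Σ (W M) P
  ; R = λ a v u → R M a (proj₁ v) (proj₁ u)
  ; V = λ p v → V M p (proj₁ v)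
  }

⟦_⟧ᴳ : GLAL AP n → (M : Structure AP n ℓ) → Pred (W M) ℓ
⟦ atom p ⟧ᴳ         M   = V M p
⟦ ¬′ φ ⟧ᴳ           M   = ∁ (⟦ φ ⟧ᴳ M)
⟦ φ ∧′ χ ⟧ᴳ         M   = ⟦ φ ⟧ᴳ M ∩ ⟦ χ ⟧ᴳ M
⟦ C A φ ⟧ᴳ          M w = Rᶜ M A w ⊆ ⟦ φ ⟧ᴳ M
⟦ [ φ ]⁺⟨ A ⟩ χ ⟧ᴳ  M w = w ∈ ⟦ φ ⟧ᴳ M → w ∈ ⟦ χ ⟧ᴳ (refine⁺ M w (⟦ φ ⟧ᴳ M) A)
⟦ [ φ ]⁻⟨ A ⟩ χ ⟧ᴳ  M w = w ∈ ⟦ φ ⟧ᴳ M → w ∈ ⟦ χ ⟧ᴳ (refine⁻ M w (⟦ φ ⟧ᴳ M) A)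

⟦_⟧ᴾ : PAL AP n → (M : Structure AP n ℓ) → Pred (W M) ℓ
⟦ atom p ⟧ᴾ    M   = V M p
⟦ ¬′ φ ⟧ᴾ      M   = ∁ (⟦ φ ⟧ᴾ M)
⟦ φ ∧′ χ ⟧ᴾ    M   = ⟦ φ ⟧ᴾ M ∩ ⟦ χ ⟧ᴾ M
⟦ C A φ ⟧ᴾ     M w = Rᶜ M A w ⊆ ⟦ φ ⟧ᴾ M
⟦ [ φ ]′ χ ⟧ᴾ  M w = (h : w ∈ ⟦ φ ⟧ᴾ M) → (w , h) ∈ ⟦ χ ⟧ᴾ (restrict M (⟦ φ ⟧ᴾ M))

Equivalent : (ℓ : Level) {AP : Set α} {n : ℕ} → GLAL AP n → PAL AP n →
             Set (α ⊔ lsuc ℓ)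
Equivalent ℓ {AP} {n} φ χ =
  (M : Model AP n ℓ) (w : Model.W M) →
  w ∈ ⟦ φ ⟧ᴳ (Model.structure M) ⇔ w ∈ ⟦ χ ⟧ᴾ (Model.structure M)

{-# OPTIONS --safe #-}
-- For (1), [ψ]χ becomes [ψ]⁺χ announced to all agents: every world reachable
-- from the current one is then split, so the reachable part of the refinement
-- is bisimilar to the restriction to ψ.  For (2), PAL is bisimulation
-- invariant, whereas a local announcement splits only the current class of an
-- agent and leaves a bisimilar copy of it intact, which common knowledge then
-- detects.
module Submission where

open import Level using (Level; _⊔_; Lift; lift)
open import Data.Bool.Base using (Bool; true; false; if_then_else_)
open import Data.Fin.Base using (Fin; zero; suc)
open import Data.Fin.Subset using (⊤; ⁅_⁆)
open import Data.Fin.Subset.Properties using (_∈?_; ∈⊤)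
open import Data.Nat.Base using (ℕ; _≤_; s≤s; z≤n)
open import Data.Product.Base using (∃; _×_; _,_; proj₁; proj₂)
open import Data.Product.Function.NonDependent.Propositional using (_×-⇔_)
open import Data.Sum.Base using (inj₁; inj₂)
open import Data.Unit.Polymorphic.Base using (tt) renaming (⊤ to Unit)
open import Function.Base using (_∘_; _on_)
open import Function.Bundles using (_⇔_; mk⇔; Equivalence)
open import Function.Construct.Composition using (_⇔-∘_)
open import Function.Construct.Identity using (⇔-id)
open import Function.Construct.Symmetry using (⇔-sym)
open import Relation.Binary.Core using (Rel; REL)
open import Relation.Binary.Structures using (IsEquivalence)
open import Relation.Binary.Construct.Closure.ReflexiveTransitive using (ε; _◅_; _◅◅_)
import Relation.Binary.Construct.On as On
open import Relation.Binary.PropositionalEquality using (_≡_; refl; sym; trans; cong; subst; isEquivalence)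
open import Relation.Nullary.Decidable.Core using (does)
open import Relation.Nullary.Decidable using (dec-true)
open import Relation.Nullary.Negation.Core using (¬_; contradiction)
open import Relation.Unary using (Pred; _∈_; _∩_)
open import Defs

open Structure
open Equivalence using (to; from)

private
  variable
    α ℓ z : Level
    AP    : Set α
    n     : ℕ

record IsBisimulation {AP : Set α} {n : ℕ} (M N : Structure AP n ℓ)
                      (Z : REL (W M) (W N) z) : Set (α ⊔ ℓ ⊔ z) where
  field
    atoms : ∀ {w v} → Z w v → ∀ p → V M p w ⇔ V N p v
    forth : ∀ {w v} → Z w v → ∀ a {w′} → R M a w w′ → ∃ λ v′ → R N a v v′ × Z w′ v′
    back  : ∀ {w v} → Z w v → ∀ a {v′} → R N a v v′ → ∃ λ w′ → R M a w w′ × Z w′ v′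

  forthᶜ : ∀ A {w v} → Z w v → ∀ {w′} → Rᶜ M A w w′ → ∃ λ v′ → Rᶜ N A v v′ × Z w′ v′
  forthᶜ A wZv ε = _ , ε , wZv
  forthᶜ A wZv ((a , a∈A , r) ◅ rs) with forth wZv a r
  ... | _ , s , uZu′ with forthᶜ A uZu′ rs
  ... | _ , ss , w′Zv′ = _ , (a , a∈A , s) ◅ ss , w′Zv′

  backᶜ : ∀ A {w v} → Z w v → ∀ {v′} → Rᶜ N A v v′ → ∃ λ w′ → Rᶜ M A w w′ × Z w′ v′
  backᶜ A wZv ε = _ , ε , wZv
  backᶜ A wZv ((a , a∈A , s) ◅ ss) with back wZv a s
  ... | _ , r , uZu′ with backᶜ A uZu′ ss
  ... | _ , rs , w′Zv′ = _ , (a , a∈A , r) ◅ rs , w′Zv′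

open IsBisimulation

≡-isBisimulation : (M : Structure AP n ℓ) → IsBisimulation M M _≡_
≡-isBisimulation M = record
  { atoms = λ { refl p → ⇔-id _ }
  ; forth = λ { refl a r → _ , r , refl }
  ; back  = λ { refl a r → _ , r , refl }
  }

module _ {X : Set ℓ} (Q : Rel X ℓ) (S P : Pred X ℓ) {v u : X} where

  split⇒ : v ∈ S ∩ P → split Q S P v u → Q v u × u ∈ P
  split⇒ v∈        (inj₁ (_ , q∧u∈P))            = q∧u∈P
  split⇒ (_ , v∈P) (inj₂ (inj₁ ((_ , v∉P) , _))) = contradiction v∈P v∉P
  split⇒ v∈        (inj₂ (inj₂ (v∉ , _)))        = contradiction v∈ v∉

  split⊆ : split Q S P v u → Q v u
  split⊆ (inj₁ (_ , q , _))        = q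
  split⊆ (inj₂ (inj₁ (_ , q , _))) = q
  split⊆ (inj₂ (inj₂ (_ , _ , q))) = q

module _ (M : Structure AP n ℓ) (w : W M) (P : Pred (W M) ℓ) where

  -- For variable `b` the test `b ∈? ⊤` does not compute, so the branch is selected by an equation
  -- between relations, used below through `subst`.
  R-refine⁺-⊤ : ∀ b → R (refine⁺ M w P ⊤) b ≡ split (R M b) (Rᶜ M ⊤ w) P
  R-refine⁺-⊤ b = cong (if_then split (R M b) (Rᶜ M ⊤ w) P else R M b)
                       (dec-true (b ∈? ⊤) ∈⊤)

  refine⁻⊆ : ∀ A b {v u} → R (refine⁻ M w P A) b v u → R M b v u
  refine⁻⊆ A b r with does (b ∈? A)
  ... | true  = split⊆ (R M b) (R M b w) P r
  ... | false = r

-- Keeping reachability from `w` in the relation places every related world in the set `Rᶜ M ⊤ w`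
-- that is split. Edges of the refinement are edges of `M`, so reachability persists along them.
refine-restrict-isBisimulation :
  {M N : Structure AP n ℓ} {Z : REL (W M) (W N) z} → IsBisimulation M N Z →
  {P : Pred (W M) ℓ} {Q : Pred (W N) ℓ} →
  (∀ {x y} → Z x y → x ∈ P ⇔ y ∈ Q) → (w : W M) →
  IsBisimulation (refine⁺ M w P ⊤) (restrict N Q)
                 (λ x y → Rᶜ M ⊤ w x × Z x (proj₁ y))
refine-restrict-isBisimulation {M = M} {N} {Z} B {P} {Q} P⇔Q w = record
  { atoms = λ (_ , xZy) → atoms B xZy
  ; forth = λ {_} {y} → forth′ {y = y}
  ; back  = λ {_} {y} → back′ {y = y}
  }
  where
  Z′ : REL (W M) (∃ Q) _
  Z′ x y = Rᶜ M ⊤ w x × Z x (proj₁ y)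

  snoc : ∀ {x x′} a → Rᶜ M ⊤ w x → R M a x x′ → Rᶜ M ⊤ w x′
  snoc a rs r = rs ◅◅ ((a , ∈⊤ , r) ◅ ε)

  forth′ : ∀ {x y} → Z′ x y → ∀ a {x′} → R (refine⁺ M w P ⊤) a x x′ →
           ∃ λ y′ → R N a (proj₁ y) (proj₁ y′) × Z′ x′ y′
  forth′ {y = _ , y∈Q} (rs , xZy) a {x′} r′
    -- The proof `y∈Q` carried by the restricted world puts `x` in `P`, so exactly the successors in
    -- `P` survive.
    with split⇒ (R M a) (Rᶜ M ⊤ w) P (rs , from (P⇔Q xZy) y∈Q)
           (subst (λ T → T _ x′) (R-refine⁺-⊤ M w P a) r′)
  ... | r , x′∈P with forth B xZy a r
  ... | _ , s , x′Zy′ = (_ , to (P⇔Q x′Zy′) x′∈P) , s , snoc a rs r , x′Zy′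

  back′ : ∀ {x y} → Z′ x y → ∀ a {y′ : ∃ Q} → R N a (proj₁ y) (proj₁ y′) →
          ∃ λ x′ → R (refine⁺ M w P ⊤) a x x′ × Z′ x′ y′
  back′ {x} {_ , y∈Q} (rs , xZy) a {_ , y′∈Q} s with back B xZy a s
  ... | x′ , r , x′Zy′ =
    x′ ,
    subst (λ T → T x x′) (sym (R-refine⁺-⊤ M w P a))
      (inj₁ ((rs , from (P⇔Q xZy) y∈Q) , r , from (P⇔Q x′Zy′) y′∈Q)) ,
    snoc a rs r , x′Zy′

translate : PAL AP n → GLAL AP n
translate (atom p)   = atom p
translate (¬′ φ)     = ¬′ translate φ
translate (φ ∧′ χ)   = translate φ ∧′ translate χ
translate (C A φ)    = C A (translate φ)
translate ([ φ ]′ χ) = [ translate φ ]⁺⟨ ⊤ ⟩ translate χ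

-- Two bisimilar structures are needed for the induction: an announcement leads to a refinement on
-- one side and a restriction on the other, which are only bisimilar. The level of `Z` varies
-- because the new relation also records reachability.
translate-correct :
  (φ : PAL AP n) {M N : Structure AP n ℓ} {Z : REL (W M) (W N) z} →
  IsBisimulation M N Z → ∀ {w v} → Z w v →
  w ∈ ⟦ translate φ ⟧ᴳ M ⇔ v ∈ ⟦ φ ⟧ᴾ N
translate-correct (atom p) B wZv = atoms B wZv p
translate-correct (¬′ φ) B wZv = mk⇔ (_∘ from φ⇔) (_∘ to φ⇔)
  where φ⇔ = translate-correct φ B wZv
translate-correct (φ ∧′ χ) B wZv =
  translate-correct φ B wZv ×-⇔ translate-correct χ B wZv
translate-correct (C A φ) B wZv = mk⇔
  (λ w⊨ {_} ss → let _ , rs , xZy = backᶜ  B A wZv ss in to   (translate-correct φ B xZy) (w⊨ rs))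
  (λ v⊨ {_} rs → let _ , ss , xZy = forthᶜ B A wZv rs in from (translate-correct φ B xZy) (v⊨ ss))
translate-correct ([ φ ]′ χ) B {w} wZv = mk⇔
  (λ w⊨ v∈φ → to (χ⇔ v∈φ) (w⊨ (from (φ⇔ wZv) v∈φ)))
  (λ v⊨ w∈φ → from (χ⇔ (to (φ⇔ wZv) w∈φ)) (v⊨ (to (φ⇔ wZv) w∈φ)))
  where
  φ⇔ = λ {x} {y} → translate-correct φ B {x} {y}
  χ⇔ = λ v∈φ → translate-correct χ (refine-restrict-isBisimulation B φ⇔ w)
                                 {v = _ , v∈φ} (ε , wZv)

-- No new induction: `translate φ` on `M` agrees with `φ` on `M` through the identity and with `φ`
-- on `N` through `Z`.
PAL-invariant :
  (φ : PAL AP n) {M N : Structure AP n ℓ} {Z : REL (W M) (W N) z} →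
  IsBisimulation M N Z → ∀ {w v} → Z w v → w ∈ ⟦ φ ⟧ᴾ M ⇔ v ∈ ⟦ φ ⟧ᴾ N
PAL-invariant φ {M} B wZv =
  translate-correct φ B wZv ⇔-∘ ⇔-sym (translate-correct φ (≡-isBisimulation M) refl)

-- K indexes bisimilar copies of the model with one true and one false world:
-- agent zero knows the copy, all other agents know the truth value.  All atoms
-- share one valuation.
copies : (AP : Set α) (n : ℕ) (K : Set ℓ) → Model AP n ℓ
copies {ℓ = ℓ} AP n K = record
  { structure = record
    { W = World
    ; R = Q
    ; V = λ _ w → proj₂ w ≡ lift true
    }
  ; isEquivalence = Q-isEquivalence
  }
  where
  World = K × Lift ℓ Bool

  Q : ∀ {n} → Fin n → Rel World ℓ
  Q zero    = _≡_ on proj₁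
  Q (suc _) = _≡_ on proj₂

  Q-isEquivalence : ∀ {n} (a : Fin n) → IsEquivalence (Q a)
  Q-isEquivalence zero    = On.isEquivalence proj₁ isEquivalence
  Q-isEquivalence (suc _) = On.isEquivalence proj₂ isEquivalence

-- A move of agent `zero` is matched inside the current copy; a move of any other agent keeps the
-- truth value and is matched by staying put.
copies-isBisimulation : (K L : Set ℓ) →
  IsBisimulation (Model.structure (copies AP n K)) (Model.structure (copies AP n L))
                 (λ w v → proj₂ w ≡ proj₂ v)
copies-isBisimulation K L = record
  { atoms = λ { refl p → ⇔-id _ }
  ; forth = λ { {v = l , _} _    zero    {_ , t} r → (l , t) , refl , refl
              ; {v = v}     refl (suc _)         r → v , refl , sym r }
  ; back  = λ { {w = k , _} _    zero    {_ , t} r → (k , t) , refl , refl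
              ; {w = w}     refl (suc _)         r → w , refl , r }
  }

distinguishing : AP → GLAL AP (ℕ.suc n)
distinguishing p = [ atom p ]⁻⟨ ⁅ zero ⁆ ⟩ C ⊤ (atom p)

-- With a single copy, the class of agent `zero` is the whole model, so the local split cuts every
-- edge from a true world to a false one.
one-copy : (p : AP) →
  (tt , lift true) ∈ ⟦ distinguishing {n = n} p ⟧ᴳ (Model.structure (copies {ℓ = ℓ} AP _ Unit))
one-copy {AP = AP} {n} {ℓ} p _ = stays-true refl
  where
  M = Model.structure (copies {ℓ = ℓ} AP (ℕ.suc n) Unit)
  w : W M
  w = tt , lift true
  M⁻ = refine⁻ M w (V M p) ⁅ zero ⁆

  stays-true : ∀ {v u} → V M p v → Rᶜ M⁻ ⊤ v u → V M p u
  stays-true v⊨p ε = v⊨p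
  stays-true v⊨p ((zero  , _ , r) ◅ rs) =
    stays-true (proj₂ (split⇒ (R M zero) (R M zero w) (V M p) (refl , v⊨p) r)) rs
  stays-true v⊨p ((suc b , _ , r) ◅ rs) =
    -- Refinement only removes edges, so the remaining ones of agent `suc b` still preserve the
    -- truth value.
    stays-true (trans (sym (refine⁻⊆ M w (V M p) ⁅ zero ⁆ (suc b) r)) v⊨p) rs

-- The other copy is reached through agent 1; its class for agent 0 is not split.
two-copies : (p : AP) →
  ¬ (lift true , lift true) ∈
    ⟦ distinguishing {n = ℕ.suc n} p ⟧ᴳ (Model.structure (copies {ℓ = ℓ} AP _ (Lift ℓ Bool)))
two-copies p w⊨ with w⊨ refl {lift false , lift false} path
  where
  path = (suc zero , ∈⊤ , refl {x = lift true})
       ◅ (zero , ∈⊤ , inj₂ (inj₂ ((λ { (() , _) }) , (λ { (() , _) }) , refl)))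
       ◅ ε
... | ()

corollary7 : ∀ {α : Level} (ℓ : Level) (AP : Set α) (n : ℕ) →
    ((φ : PAL AP n) → ∃ λ (χ : GLAL AP n) → Equivalent ℓ χ φ)
    × (AP → 2 ≤ n →
    ∃ λ (χ : GLAL AP n) → (φ : PAL AP n) → ¬ Equivalent ℓ χ φ)
corollary7 ℓ AP n = embedding , strictness
  where
  embedding : (φ : PAL AP n) → ∃ λ (χ : GLAL AP n) → Equivalent ℓ χ φ
  embedding φ = translate φ , λ M w →
    translate-correct φ (≡-isBisimulation (Model.structure M)) refl

  strictness : AP → 2 ≤ n → ∃ λ (χ : GLAL AP n) → (φ : PAL AP n) → ¬ Equivalent ℓ χ φ
  -- Matching on `2 ≤ n` exposes agents 0 and 1. An equivalent `φ` would carry truth from one copy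
  -- to two by bisimulation invariance.
  strictness p (s≤s (s≤s z≤n)) = distinguishing p , λ φ χ≡φ →
    two-copies p (from (χ≡φ (copies AP _ (Lift ℓ Bool)) _)
      (to (PAL-invariant φ (copies-isBisimulation Unit (Lift ℓ Bool)) refl)
        (to (χ≡φ (copies AP _ Unit) _) (one-copy p))))
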